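{- Consider the random basic walk on the infinite hexagonal lattice (the $3$-regular planar honeycomb graph). For any starting vertex and any initial port, the random basic walk cycles with probability $1$.
   Context: Graphs are connected, countable and locally finite; each undirected edge $\{v,w\}$ is regarded as two arcs $v\to w$ and $w\to v$. A labeling assigns, at each vertex $v$ of degree $\deg(v)$, the port numbers $1,\dots,\deg(v)$ bijectively to the arcs leaving $v$ (labels on $v\to w$ and $w\to v$ need not agree). In a random labeling these bijections are chosen uniformly at random, independently for different vertices. Given a labeling, a starting vertex $v_0$ and an initial port $\ell$, the basic walk leaves $v_0$ along the arc labeled $\ell$; thereafter, whenever it enters a vertex $v$ along an arc whose label is $i$, it leaves $v$ along the arc out of $v$ labeled $(i \bmod \deg(v))+1$. The random basic walk is the basic walk for a random labeling. The walk cycles if some arc is traversed twice in the same direction (equivalently, from some point on it is periodic and visits only finitely many vertices); it is transient otherwise. -}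

module Defs where

open import Data.Empty using (⊥)
open import Data.Fin.Base using (Fin; zero; suc; toℕ)
open import Data.Fin.Permutation using (Permutation′; _⟨$⟩ʳ_; _⟨$⟩ˡ_; _≈_)
open import Data.Fin.Properties using (nonZeroIndex)
open import Data.Integer.Base as ℤ using (ℤ; +_; -[1+_]; 0ℤ)
open import Data.Integer.Properties using (suc-pred; pred-suc; i≢suc[i])
open import Data.List.Base using (List; []; _∷_; map; foldr)
open import Data.List.Relation.Unary.All using (All)
open import Data.List.Relation.Unary.Unique.Propositional using (Unique)
open import Data.Maybe.Base using (Maybe; just; nothing)
open import Data.Nat.Base as ℕ using (ℕ; zero; suc; NonZero; _!)
open import Data.Nat.DivMod using (_mod_)
open import Data.Nat.Properties using (_!≢0)
open import Data.Product.Base using (Σ; ∃-syntax; _×_; _,_; proj₁)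
open import Data.Rational.Base as ℚ using (ℚ; 0ℚ; 1ℚ)
open import Relation.Binary.Construct.Closure.ReflexiveTransitive using (Star; ε; _◅_; _◅◅_; reverse)
open import Relation.Binary.PropositionalEquality using (_≡_; _≢_; refl; sym; trans; cong)
open import Relation.Nullary.Negation.Core using (¬_; contradiction)

-- Connected, locally finite simple graphs (hence countable).  The arcs leaving
-- v are indexed by Fin (deg v); this reference indexing is unrelated to the
-- port numbers, which come from a Labeling below.
record Graph : Set₁ where
  field
    Vertex    : Set
    deg       : Vertex → ℕ
    nbr       : (v : Vertex) → Fin (deg v) → Vertex
    simple    : ∀ v {i j} → nbr v i ≡ nbr v j → i ≡ j
    loopless  : ∀ v i → nbr v i ≢ v
    symmetric : ∀ v i → ∃[ j ] nbr (nbr v i) j ≡ v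
    connected : ∀ u v → Star (λ x y → ∃[ i ] nbr x i ≡ y) u v

module _ (G : Graph) where
  open Graph G

  record Arc : Set where
    constructor arc
    field
      tail : Vertex
      out  : Fin (deg tail)

    head : Vertex
    head = nbr tail out

  open Arc

  -- ω v sends each arc leaving v to its port; the element p of Fin (deg v)
  -- stands for the port number 1 + toℕ p.
  Labeling : Set
  Labeling = (v : Vertex) → Permutation′ (deg v)

  label : Labeling → Arc → ℕ
  label ω a = suc (toℕ (ω (tail a) ⟨$⟩ʳ out a))

  leaveBy : Labeling → (v : Vertex) → Fin (deg v) → Arc
  leaveBy ω v p = arc v (ω v ⟨$⟩ˡ p)

  head-deg≢0 : (a : Arc) → NonZero (deg (head a))
  head-deg≢0 a = nonZeroIndex (proj₁ (symmetric (tail a) (out a)))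

  -- The label i of the entering arc a is the one given at the tail of a.
  -- The port number (i mod deg) + 1 is the element i mod deg of Fin deg.
  next : Labeling → Arc → Arc
  next ω a = leaveBy ω (head a) (_mod_ (label ω a) (deg (head a)) {{head-deg≢0 a}})

  -- walk ω v₀ ℓ t is the arc traversed in step t (counting from 0).
  walk : Labeling → (v₀ : Vertex) → Fin (deg v₀) → ℕ → Arc
  walk ω v₀ ℓ zero    = leaveBy ω v₀ ℓ
  walk ω v₀ ℓ (suc t) = next ω (walk ω v₀ ℓ t)

  Cycles : (v₀ : Vertex) → Fin (deg v₀) → Labeling → Set
  Cycles v₀ ℓ ω = ∃[ s ] ∃[ t ] s ℕ.< t × walk ω v₀ ℓ s ≡ walk ω v₀ ℓ t

  -- A cylinder prescribes the bijections at finitely many distinct vertices.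
  record Cylinder : Set where
    field
      prescribed : List (Σ Vertex (λ v → Permutation′ (deg v)))
      distinct   : Unique (map proj₁ prescribed)

  open Cylinder

  _∈ᶜ_ : Labeling → Cylinder → Set
  ω ∈ᶜ C = All (λ (v , π) → ω v ≈ π) (prescribed C)

  -- Uniform bijections, independent over the vertices: each prescribed vertex v
  -- contributes a factor 1 / (deg v)!.
  probᶜ : Cylinder → ℚ
  probᶜ C = foldr (λ (v , _) q → ℚ._/_ (+ 1) (deg v !) {{deg v !≢0}} ℚ.* q) 1ℚ (prescribed C)

  -- A countable family of cylinders; nothing stands for the empty set.
  Family : Set
  Family = ℕ → Maybe Cylinder

  prob : Maybe Cylinder → ℚ
  prob nothing  = 0ℚ
  prob (just C) = probᶜ C

  _∈ᵐ_ : Labeling → Maybe Cylinder → Set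
  ω ∈ᵐ nothing = ⊥
  ω ∈ᵐ just C  = ω ∈ᶜ C

  partialSum : Family → ℕ → ℚ
  partialSum F zero    = 0ℚ
  partialSum F (suc n) = partialSum F n ℚ.+ prob (F n)

  -- Outer measure zero for the (Carathéodory extended) product measure: there
  -- are countable covers by cylinders of arbitrarily small total probability.
  ProbabilityZero : (Labeling → Set) → Set
  ProbabilityZero A = (δ : ℚ) → 0ℚ ℚ.< δ →
    ∃[ F ] (∀ n → partialSum F n ℚ.≤ δ) × (∀ ω → A ω → ∃[ k ] ω ∈ᵐ F k)

  ProbabilityOne : (Labeling → Set) → Set
  ProbabilityOne A = ProbabilityZero (λ ω → ¬ A ω)

-- The honeycomb: one black and one white vertex in each unit cell (a , b) of
-- the underlying triangular Bravais lattice, in lattice coordinates.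
data HexVertex : Set where
  black white : (a b : ℤ) → HexVertex

hexNbr : HexVertex → Fin 3 → HexVertex
hexNbr (black a b) zero             = white a b
hexNbr (black a b) (suc zero)       = white (ℤ.pred a) b
hexNbr (black a b) (suc (suc zero)) = white a (ℤ.pred b)
hexNbr (white a b) zero             = black a b
hexNbr (white a b) (suc zero)       = black (ℤ.suc a) b
hexNbr (white a b) (suc (suc zero)) = black a (ℤ.suc b)

private
  coordA coordB : HexVertex → ℤ
  coordA (black a b) = a
  coordA (white a b) = a
  coordB (black a b) = b
  coordB (white a b) = b

  i≢pred[i] : ∀ {i} → i ≢ ℤ.pred i
  i≢pred[i] {i} e = i≢suc[i] {ℤ.pred i} (trans (sym e) (sym (suc-pred i)))

  hexSimple : ∀ v {i j} → hexNbr v i ≡ hexNbr v j → i ≡ j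
  hexSimple v {zero} {zero} e = refl
  hexSimple v {suc zero} {suc zero} e = refl
  hexSimple v {suc (suc zero)} {suc (suc zero)} e = refl
  hexSimple (black a b) {zero} {suc zero} e = contradiction (cong coordA e) i≢pred[i]
  hexSimple (black a b) {zero} {suc (suc zero)} e = contradiction (cong coordB e) i≢pred[i]
  hexSimple (black a b) {suc zero} {zero} e = contradiction (cong coordA (sym e)) i≢pred[i]
  hexSimple (black a b) {suc zero} {suc (suc zero)} e = contradiction (cong coordB e) i≢pred[i]
  hexSimple (black a b) {suc (suc zero)} {zero} e = contradiction (cong coordB (sym e)) i≢pred[i]
  hexSimple (black a b) {suc (suc zero)} {suc zero} e = contradiction (cong coordA e) i≢pred[i]
  hexSimple (white a b) {zero} {suc zero} e = contradiction (cong coordA e) i≢suc[i]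
  hexSimple (white a b) {zero} {suc (suc zero)} e = contradiction (cong coordB e) i≢suc[i]
  hexSimple (white a b) {suc zero} {zero} e = contradiction (cong coordA (sym e)) i≢suc[i]
  hexSimple (white a b) {suc zero} {suc (suc zero)} e = contradiction (cong coordB e) i≢suc[i]
  hexSimple (white a b) {suc (suc zero)} {zero} e = contradiction (cong coordB (sym e)) i≢suc[i]
  hexSimple (white a b) {suc (suc zero)} {suc zero} e = contradiction (cong coordA e) i≢suc[i]

  hexLoopless : ∀ v i → hexNbr v i ≢ v
  hexLoopless (black a b) zero ()
  hexLoopless (black a b) (suc zero) ()
  hexLoopless (black a b) (suc (suc zero)) ()
  hexLoopless (white a b) zero ()
  hexLoopless (white a b) (suc zero) ()
  hexLoopless (white a b) (suc (suc zero)) ()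

  hexSymmetric : ∀ v i → ∃[ j ] hexNbr (hexNbr v i) j ≡ v
  hexSymmetric (black a b) zero             = zero , refl
  hexSymmetric (black a b) (suc zero)       = suc zero , cong (λ x → black x b) (suc-pred a)
  hexSymmetric (black a b) (suc (suc zero)) = suc (suc zero) , cong (black a) (suc-pred b)
  hexSymmetric (white a b) zero             = zero , refl
  hexSymmetric (white a b) (suc zero)       = suc zero , cong (λ x → white x b) (pred-suc a)
  hexSymmetric (white a b) (suc (suc zero)) = suc (suc zero) , cong (white a) (pred-suc b)

  HexAdj : HexVertex → HexVertex → Set
  HexAdj u v = ∃[ i ] hexNbr u i ≡ v

  Path : HexVertex → HexVertex → Set
  Path = Star HexAdj

  flip : ∀ {u v} → Path u v → Path v u
  flip = reverse λ { {u} (i , refl) → hexSymmetric u i }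

  ℤ-path : (f : ℤ → HexVertex) → (∀ a → Path (f a) (f (ℤ.suc a))) → ∀ a → Path (f 0ℤ) (f a)
  ℤ-path f step (+ zero)     = ε
  ℤ-path f step (+ suc n)    = ℤ-path f step (+ n) ◅◅ step (+ n)
  ℤ-path f step -[1+ zero ]  = flip (step -[1+ 0 ])
  ℤ-path f step -[1+ suc n ] = ℤ-path f step -[1+ n ] ◅◅ flip (step -[1+ suc n ])

  fromOrigin : ∀ v → Path (black 0ℤ 0ℤ) v
  fromOrigin (black a b) =
    ℤ-path (λ x → black x 0ℤ) (λ _ → (zero , refl) ◅ (suc zero , refl) ◅ ε) a ◅◅
    ℤ-path (black a) (λ _ → (zero , refl) ◅ (suc (suc zero) , refl) ◅ ε) b
  fromOrigin (white a b) = fromOrigin (black a b) ◅◅ (zero , refl) ◅ ε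

hexagonalLattice : Graph
hexagonalLattice = record
  { Vertex    = HexVertex
  ; deg       = λ _ → 3
  ; nbr       = hexNbr
  ; simple    = hexSimple
  ; loopless  = hexLoopless
  ; symmetric = hexSymmetric
  ; connected = λ u v → flip (fromOrigin u) ◅◅ fromOrigin v
  }

{-# OPTIONS --safe #-}
module Submission where

-- In a 3-regular graph the ports used by the walk are ℓ, ℓ+1, ℓ+2, … mod 3, so
-- the walk is the orbit of a map on pairs (vertex, port).
-- Reveal the labeling on a box.  Either the walk stays in the box, and then it
-- cycles by the pigeonhole principle, or it leaves the box along an arc u → c.
-- In the honeycomb the vertex c and its other two neighbours x₁, x₂ then all
-- lie outside the box, so their labels are still fresh, and with probability at
-- least 6⁻³ these labels close the loop u → c → x₁ → c → x₂ → c → u of length 6,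
-- which returns to u with the same port.
-- Repeating this with larger and larger boxes, the labelings that survive n
-- attempts are covered by cylinders of total probability at most (215/216)ⁿ.

open import Defs
open import Data.Fin.Base using (Fin; zero; suc; toℕ)
open import Data.Fin.Patterns using (0F; 1F; 2F)
open import Data.Fin.Permutation using (Permutation′; permutation; transpose; id; flip; _∘ₚ_; _≈_; _⟨$⟩ʳ_; _⟨$⟩ˡ_; inverseˡ; inverseʳ)
open import Data.Fin.Properties using (pigeonhole; toℕ<n)
open import Data.Integer.Base as ℤ using (ℤ; +_; -[1+_]; +[1+_]; ∣_∣)
import Data.Integer.Properties as ℤ
open import Data.List.Base using (List; []; _∷_; _++_; map; length; lookup; allFin; cartesianProduct; cartesianProductWith)
open import Data.List.Membership.Propositional using (_∈_; _∉_)
open import Data.List.Membership.Propositional.Properties using (∈-allFin; ∈-cartesianProduct⁺; ∈-cartesianProductWith⁺; ∈-cartesianProductWith⁻; ∈-++⁺ˡ; ∈-++⁺ʳ; ∈-++⁻)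
open import Data.List.Relation.Unary.All using (All; []; _∷_)
open import Data.List.Relation.Unary.All.Properties using (¬Any⇒All¬)
open import Data.List.Relation.Unary.AllPairs using ([]; _∷_)
open import Data.List.Relation.Unary.Any as Any using (Any; here; there)
open import Data.List.Relation.Unary.Any.Properties using (++⁺ˡ; ++⁺ʳ; lookup-index)
open import Data.Maybe.Base using (just; nothing)
open import Data.Nat.DivMod using (_mod_)
open import Data.Nat.Base as ℕ using (ℕ; zero; suc; _⊔_; z≤n; s≤s)
import Data.Nat.Properties as ℕ
open import Data.Product.Base using (Σ-syntax; ∃-syntax; _×_; _,_; proj₁; proj₂)
open import Data.Rational.Base as ℚ using (ℚ; 0ℚ; 1ℚ; _+_; _*_; -_; _≤_; _/_; 1/_; NonNegative; Positive)
import Data.Rational.Properties as ℚ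
open import Data.Rational.Solver using (module +-*-Solver)
import Data.Rational.Unnormalised.Base as ℚᵘ
import Data.Rational.Unnormalised.Properties as ℚᵘ
open import Data.Sum.Base using (_⊎_; inj₁; inj₂; [_,_]′)
open import Function.Base using (_∘_; _$_)
open import Relation.Binary.Definitions using (DecidableEquality)
open import Relation.Binary.PropositionalEquality using (_≡_; _≢_; refl; sym; trans; cong; cong₂; subst; module ≡-Reasoning)
open import Relation.Nullary using (¬_; Dec; yes; no; contradiction)
open import Relation.Nullary.Decidable using (map′; _×-dec_)

private
  G : Graph
  G = hexagonalLattice

  Perm : Set
  Perm = Permutation′ 3

-- Geometric decay in ℚ

-- The embedding of the naturals, given by recursion so that the successor step of `bernoulli` is a
-- polynomial identity.
ι : ℕ → ℚ
ι zero    = 0ℚ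
ι (suc n) = 1ℚ + ι n

toℚᵘ-ι : ∀ n → ℚ.toℚᵘ (ι n) ℚᵘ.≃ ℚᵘ.mkℚᵘ (+ n) 0
toℚᵘ-ι zero    = ℚᵘ.≃-refl
toℚᵘ-ι (suc n) = ℚᵘ.≃-trans (ℚ.toℚᵘ-homo-+ 1ℚ (ι n))
  (ℚᵘ.≃-trans (ℚᵘ.+-congʳ ℚᵘ.1ℚᵘ (toℚᵘ-ι n))
    (ℚᵘ.*≡* (cong (ℤ._* + 1) (cong (λ x → + 1 ℤ.+ x) (ℤ.*-identityʳ (+ n))))))

-- A denominator is at least 1, so the absolute value of the numerator is already a bound.
archimedean : ∀ x → ∃[ n ] x ≤ ι n
archimedean x = ∣ ℚ.↥ x ∣ , ℚ.toℚᵘ-cancel-≤ (ℚᵘ.≤-trans (bound x) (ℚᵘ.≤-reflexive (ℚᵘ.≃-sym (toℚᵘ-ι ∣ ℚ.↥ x ∣))))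
  where
  bound : ∀ x → ℚ.toℚᵘ x ℚᵘ.≤ ℚᵘ.mkℚᵘ (+ ∣ ℚ.↥ x ∣) 0
  bound (ℚ.mkℚ (+ n)    d _) = ℚᵘ.*≤* (ℤ.*-monoˡ-≤-nonNeg (+ n) (ℤ.+≤+ (s≤s z≤n)))
  bound (ℚ.mkℚ -[1+ n ] d _) = ℚᵘ.*≤* ℤ.-≤+

ratio : ℚ
ratio = + 215 / 216

ratio^_ : ℕ → ℚ
ratio^ zero  = 1ℚ
ratio^ suc n = ratio * ratio^ n

ratio^-nonNeg : ∀ n → NonNegative (ratio^ n)
ratio^-nonNeg zero    = _
ratio^-nonNeg (suc n) = ℚ.nonNeg*nonNeg⇒nonNeg ratio (ratio^ n) {{ratio^-nonNeg n}}

ι-nonNeg : ∀ n → NonNegative (ι n)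
ι-nonNeg zero    = _
ι-nonNeg (suc n) = ℚ.nonNeg+nonNeg⇒nonNeg 1ℚ (ι n) {{ι-nonNeg n}}

private
  c215 : ℚ
  c215 = + 215 / 1

-- Bernoulli's inequality (216/215)ⁿ ≥ 1 + n/215, cleared of division. The induction rests on
-- (215/216)(216 + x) = 215 + x - x/216.
bernoulli : ∀ n → ratio^ n * (c215 + ι n) ≤ c215
bernoulli zero    = ℚ.≤-refl
bernoulli (suc n) = begin
  ratio * ratio^ n * (c215 + (1ℚ + ι n))                              ≡⟨ regroup (ratio^ n) (ι n) ⟩
  ratio^ n * (c215 + ι n + - 216⁻¹ * ι n)                             ≤⟨ ℚ.*-monoˡ-≤-nonNeg (ratio^ n) {{ratio^-nonNeg n}} drop ⟩
  ratio^ n * (c215 + ι n)                                             ≤⟨ bernoulli n ⟩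
  c215                                                                ∎
  where
  open ℚ.≤-Reasoning
  open +-*-Solver
  216⁻¹ : ℚ
  216⁻¹ = + 1 / 216
  regroup : ∀ r x → ratio * r * (c215 + (1ℚ + x)) ≡ r * (c215 + x + - 216⁻¹ * x)
  regroup = solve 2 (λ r x → con ratio :* r :* (con c215 :+ (con 1ℚ :+ x)) := r :* (con c215 :+ x :+ con (- 216⁻¹) :* x)) refl
  drop : c215 + ι n + - 216⁻¹ * ι n ≤ c215 + ι n
  drop = begin
    c215 + ι n + - 216⁻¹ * ι n ≤⟨ ℚ.+-monoʳ-≤ (c215 + ι n) (ℚ.*-monoʳ-≤-nonNeg (ι n) {{ι-nonNeg n}} (ℚ.nonPositive⁻¹ (- 216⁻¹))) ⟩
    c215 + ι n + 0ℚ * ι n      ≡⟨ solve 1 (λ x → con c215 :+ x :+ con 0ℚ :* x := con c215 :+ x) refl (ι n) ⟩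
    c215 + ι n                 ∎

-- For n ≥ 215/δ, `bernoulli` bounds the power by 215/(215 + n) ≤ 215/n ≤ δ.
ratio^→0 : ∀ δ → 0ℚ ℚ.< δ → ∃[ n ] ratio^ n ≤ δ
ratio^→0 δ δ>0 = n , (begin
  ratio^ n                                           ≡⟨ sym (ℚ.*-identityʳ (ratio^ n)) ⟩
  ratio^ n * 1ℚ                                      ≡⟨ cong (ratio^ n *_) (sym (ℚ.*-inverseˡ δ)) ⟩
  ratio^ n * (1/ δ * δ)                              ≡⟨ regroup (ratio^ n) (1/ δ) δ ⟩
  ratio^ n * (c215 * 1/ δ) * (215⁻¹ * δ)             ≤⟨ mono (ℚ.*-monoˡ-≤-nonNeg (ratio^ n) {{ratio^-nonNeg n}} large) ⟩
  ratio^ n * ι n * (215⁻¹ * δ)                       ≤⟨ mono (ℚ.*-monoˡ-≤-nonNeg (ratio^ n) {{ratio^-nonNeg n}} ιn≤) ⟩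
  ratio^ n * (c215 + ι n) * (215⁻¹ * δ)              ≤⟨ mono (bernoulli n) ⟩
  c215 * (215⁻¹ * δ)                                 ≡⟨ solve 1 (λ y → con c215 :* (con 215⁻¹ :* y) := y) refl δ ⟩
  δ                                                  ∎)
  where
  open ℚ.≤-Reasoning
  open +-*-Solver
  215⁻¹ : ℚ
  215⁻¹ = + 1 / 215
  instance
    δ-pos : Positive δ
    δ-pos = ℚ.positive δ>0
    δ-nonZero : ℚ.NonZero δ
    δ-nonZero = ℚ.pos⇒nonZero δ
  n : ℕ
  n = proj₁ (archimedean (c215 * 1/ δ))
  large : c215 * 1/ δ ≤ ι n
  large = proj₂ (archimedean (c215 * 1/ δ))
  mono : ∀ {x y} → x ≤ y → x * (215⁻¹ * δ) ≤ y * (215⁻¹ * δ)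
  mono = ℚ.*-monoʳ-≤-nonNeg (215⁻¹ * δ) {{ℚ.nonNeg*nonNeg⇒nonNeg 215⁻¹ δ {{ℚ.pos⇒nonNeg δ}}}}
  ιn≤ : ι n ≤ c215 + ι n
  ιn≤ = ℚ.≤-trans (ℚ.≤-reflexive (sym (ℚ.+-identityˡ (ι n)))) (ℚ.+-monoˡ-≤ (ι n) (ℚ.nonNegative⁻¹ c215))
  regroup : ∀ r x y → r * (x * y) ≡ r * (c215 * x) * (215⁻¹ * y)
  regroup = solve 3 (λ r x y → r :* (x :* y) := r :* (con c215 :* x) :* (con 215⁻¹ :* y)) refl

-- Finite covers by cylinders

open Cylinder using (prescribed; distinct)

Cyl : Set
Cyl = Cylinder G

total : List Cyl → ℚ
total []       = 0ℚ
total (C ∷ Cs) = probᶜ G C + total Cs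

total-++ : ∀ Cs Ds → total (Cs ++ Ds) ≡ total Cs + total Ds
total-++ []       Ds = sym (ℚ.+-identityˡ (total Ds))
total-++ (C ∷ Cs) Ds = trans (cong (λ s → probᶜ G C + s) (total-++ Cs Ds)) (sym (ℚ.+-assoc (probᶜ G C) (total Cs) (total Ds)))

Coverable : (Labeling G → Set) → ℚ → Set
Coverable P x = Σ[ Cs ∈ List Cyl ] total Cs ≤ x × (∀ ω → P ω → Any (_∈ᶜ_ G ω) Cs)

module _ {P Q : Labeling G → Set} {x y : ℚ} where

  coverable-weaken : x ≤ y → (∀ ω → Q ω → P ω) → Coverable P x → Coverable Q y
  coverable-weaken x≤y Q⇒P (Cs , Cs≤x , cov) = Cs , ℚ.≤-trans Cs≤x x≤y , λ ω Qω → cov ω (Q⇒P ω Qω)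

  coverable-∪ : Coverable P x → Coverable Q y → Coverable (λ ω → P ω ⊎ Q ω) (x + y)
  coverable-∪ (Cs , Cs≤x , covP) (Ds , Ds≤y , covQ) =
    Cs ++ Ds ,
    ℚ.≤-trans (ℚ.≤-reflexive (total-++ Cs Ds)) (ℚ.+-mono-≤ Cs≤x Ds≤y) ,
    λ ω → [ ++⁺ˡ ∘ covP ω , ++⁺ʳ Cs ∘ covQ ω ]′

probᶜ-nonNeg : ∀ C → NonNegative (probᶜ G C)
probᶜ-nonNeg C = go (prescribed C) (distinct C)
  where
  go : ∀ σ u → NonNegative (probᶜ G (record { prescribed = σ ; distinct = u }))
  go []      _       = _
  go (_ ∷ σ) (_ ∷ u) =
    ℚ.nonNeg*nonNeg⇒nonNeg (+ 1 / 6) (probᶜ G (record { prescribed = σ ; distinct = u })) {{go σ u}}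

family : List Cyl → Family G
family []       _       = nothing
family (C ∷ Cs) zero    = just C
family (C ∷ Cs) (suc k) = family Cs k

family-covers : ∀ {ω Cs} → Any (_∈ᶜ_ G ω) Cs → ∃[ k ] _∈ᵐ_ G ω (family Cs k)
family-covers (here ω∈C) = zero , ω∈C
family-covers (there p)  = let k , ω∈F = family-covers p in suc k , ω∈F

partialSum-family : ∀ Cs n → partialSum G (family Cs) n ≤ total Cs
partialSum-family []       zero    = ℚ.≤-refl
partialSum-family []       (suc n) = ℚ.≤-trans (ℚ.≤-reflexive (ℚ.+-identityʳ _)) (partialSum-family [] n)
partialSum-family (C ∷ Cs) n       = go n
  where
  -- `partialSum` grows at its far end while `total` peels off the front, so the first term has to
  -- be moved across the sum.
  cons : ∀ n → partialSum G (family (C ∷ Cs)) (suc n) ≡ probᶜ G C + partialSum G (family Cs) n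
  cons zero    = ℚ.+-comm 0ℚ (probᶜ G C)
  cons (suc n) = trans (cong (_+ prob G (family Cs n)) (cons n)) (ℚ.+-assoc (probᶜ G C) _ _)
  go : ∀ n → partialSum G (family (C ∷ Cs)) n ≤ probᶜ G C + total Cs
  go zero    = ℚ.+-mono-≤ {0ℚ} {probᶜ G C} {0ℚ} {total Cs} (ℚ.nonNegative⁻¹ (probᶜ G C) {{probᶜ-nonNeg C}}) (partialSum-family Cs 0)
  go (suc n) = ℚ.≤-trans (ℚ.≤-reflexive (cons n)) (ℚ.+-monoʳ-≤ (probᶜ G C) (partialSum-family Cs n))

coverable⇒null : ∀ {P} → (∀ δ → 0ℚ ℚ.< δ → Coverable P δ) → ProbabilityZero G P
coverable⇒null cover δ δ>0 =
  let Cs , Cs≤δ , cov = cover δ δ>0 in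
  family Cs , (λ n → ℚ.≤-trans (partialSum-family Cs n) Cs≤δ) , λ ω Pω → family-covers (cov ω Pω)

-- Permutations of three elements

private
  σ₁ σ₂ σ₃ σ₄ σ₅ : Perm
  σ₁ = transpose 0F 1F
  σ₂ = transpose 0F 2F
  σ₃ = transpose 1F 2F
  σ₄ = σ₁ ∘ₚ σ₃
  σ₅ = σ₃ ∘ₚ σ₁

⟨$⟩ʳ-injective : ∀ (ρ : Perm) {i j} → ρ ⟨$⟩ʳ i ≡ ρ ⟨$⟩ʳ j → i ≡ j
⟨$⟩ʳ-injective ρ e = trans (sym (inverseˡ ρ)) (trans (cong (ρ ⟨$⟩ˡ_) e) (inverseˡ ρ))

≈⇒⟨$⟩ˡ : ∀ (π ρ : Perm) → π ≈ ρ → ∀ i → π ⟨$⟩ˡ i ≡ ρ ⟨$⟩ˡ i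
≈⇒⟨$⟩ˡ π ρ π≈ρ i = ⟨$⟩ʳ-injective ρ (trans (sym (π≈ρ _)) (trans (inverseʳ π) (sym (inverseʳ ρ))))

-- The three values determine the permutation, and injectivity excludes every pattern with a
-- repetition.
perm₃ : (ρ : Perm) → ρ ≈ id ⊎ ρ ≈ σ₁ ⊎ ρ ≈ σ₂ ⊎ ρ ≈ σ₃ ⊎ ρ ≈ σ₄ ⊎ ρ ≈ σ₅
perm₃ ρ with ρ ⟨$⟩ʳ 0F in e₀ | ρ ⟨$⟩ʳ 1F in e₁ | ρ ⟨$⟩ʳ 2F in e₂
... | 0F | 1F | 2F = inj₁ λ { 0F → e₀ ; 1F → e₁ ; 2F → e₂ }
... | 1F | 0F | 2F = inj₂ (inj₁ λ { 0F → e₀ ; 1F → e₁ ; 2F → e₂ })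
... | 2F | 1F | 0F = inj₂ (inj₂ (inj₁ λ { 0F → e₀ ; 1F → e₁ ; 2F → e₂ }))
... | 0F | 2F | 1F = inj₂ (inj₂ (inj₂ (inj₁ λ { 0F → e₀ ; 1F → e₁ ; 2F → e₂ })))
... | 2F | 0F | 1F = inj₂ (inj₂ (inj₂ (inj₂ (inj₁ λ { 0F → e₀ ; 1F → e₁ ; 2F → e₂ }))))
... | 1F | 2F | 0F = inj₂ (inj₂ (inj₂ (inj₂ (inj₂ λ { 0F → e₀ ; 1F → e₁ ; 2F → e₂ }))))
... | 0F | 0F | _  = contradiction (⟨$⟩ʳ-injective ρ (trans e₀ (sym e₁))) λ ()
... | 1F | 1F | _  = contradiction (⟨$⟩ʳ-injective ρ (trans e₀ (sym e₁))) λ ()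
... | 2F | 2F | _  = contradiction (⟨$⟩ʳ-injective ρ (trans e₀ (sym e₁))) λ ()
... | 0F | 1F | 0F = contradiction (⟨$⟩ʳ-injective ρ (trans e₀ (sym e₂))) λ ()
... | 0F | 2F | 0F = contradiction (⟨$⟩ʳ-injective ρ (trans e₀ (sym e₂))) λ ()
... | 1F | 0F | 1F = contradiction (⟨$⟩ʳ-injective ρ (trans e₀ (sym e₂))) λ ()
... | 1F | 2F | 1F = contradiction (⟨$⟩ʳ-injective ρ (trans e₀ (sym e₂))) λ ()
... | 2F | 0F | 2F = contradiction (⟨$⟩ʳ-injective ρ (trans e₀ (sym e₂))) λ ()
... | 2F | 1F | 2F = contradiction (⟨$⟩ʳ-injective ρ (trans e₀ (sym e₂))) λ ()
... | 0F | 1F | 1F = contradiction (⟨$⟩ʳ-injective ρ (trans e₁ (sym e₂))) λ ()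
... | 0F | 2F | 2F = contradiction (⟨$⟩ʳ-injective ρ (trans e₁ (sym e₂))) λ ()
... | 1F | 0F | 0F = contradiction (⟨$⟩ʳ-injective ρ (trans e₁ (sym e₂))) λ ()
... | 1F | 2F | 2F = contradiction (⟨$⟩ʳ-injective ρ (trans e₁ (sym e₂))) λ ()
... | 2F | 0F | 0F = contradiction (⟨$⟩ʳ-injective ρ (trans e₁ (sym e₂))) λ ()
... | 2F | 1F | 1F = contradiction (⟨$⟩ʳ-injective ρ (trans e₁ (sym e₂))) λ ()

rot : Fin 3 → Fin 3
rot 0F = 1F
rot 1F = 2F
rot 2F = 0F

rot³ : ∀ i → rot (rot (rot i)) ≡ i
rot³ 0F = refl
rot³ 1F = refl
rot³ 2F = refl

rot-≢ : ∀ i → rot i ≢ i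
rot-≢ 0F ()
rot-≢ 1F ()
rot-≢ 2F ()

rot²-≢ : ∀ i → rot (rot i) ≢ i
rot²-≢ 0F ()
rot²-≢ 1F ()
rot²-≢ 2F ()

rotBy : Fin 3 → Perm
rotBy 0F = id
rotBy 1F = permutation rot (rot ∘ rot) rot³ rot³
rotBy 2F = flip (rotBy 1F)

-- The rotation x ↦ x - i + k mod 3. Read backwards, it sends port k to direction i and commutes
-- with `rot`.
align : (k i : Fin 3) → Perm
align k i = flip (rotBy i) ∘ₚ rotBy k

align-0 : ∀ k i → align k i ⟨$⟩ˡ k ≡ i
align-0 0F 0F = refl
align-0 0F 1F = refl
align-0 0F 2F = refl
align-0 1F 0F = refl
align-0 1F 1F = refl
align-0 1F 2F = refl
align-0 2F 0F = refl
align-0 2F 1F = refl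
align-0 2F 2F = refl

align-1 : ∀ k i → align k i ⟨$⟩ˡ rot k ≡ rot i
align-1 0F 0F = refl
align-1 0F 1F = refl
align-1 0F 2F = refl
align-1 1F 0F = refl
align-1 1F 1F = refl
align-1 1F 2F = refl
align-1 2F 0F = refl
align-1 2F 1F = refl
align-1 2F 2F = refl

align-2 : ∀ k i → align k i ⟨$⟩ˡ rot (rot k) ≡ rot (rot i)
align-2 0F 0F = refl
align-2 0F 1F = refl
align-2 0F 2F = refl
align-2 1F 0F = refl
align-2 1F 1F = refl
align-2 1F 2F = refl
align-2 2F 0F = refl
align-2 2F 1F = refl
align-2 2F 2F = refl

-- Revealing the labeling vertex by vertex

dom : Cyl → List HexVertex
dom C = map proj₁ (prescribed C)

extend : ∀ v → Perm → ∀ C → v ∉ dom C → Cyl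
extend v π C v∉C = record { prescribed = (v , π) ∷ prescribed C ; distinct = ¬Any⇒All¬ (dom C) v∉C ∷ distinct C }

empty : Cyl
empty = record { prescribed = [] ; distinct = [] }

_≟ᵛ_ : DecidableEquality HexVertex
black a b ≟ᵛ black c d = map′ (λ { (refl , refl) → refl }) (λ { refl → refl , refl }) (a ℤ.≟ c ×-dec b ℤ.≟ d)
white a b ≟ᵛ white c d = map′ (λ { (refl , refl) → refl }) (λ { refl → refl , refl }) (a ℤ.≟ c ×-dec b ℤ.≟ d)
black _ _ ≟ᵛ white _ _ = no λ ()
white _ _ ≟ᵛ black _ _ = no λ ()

open import Data.List.Membership.DecPropositional _≟ᵛ_ using (_∈?_)

module Covering (A : Labeling G → Set) where

  -- Here q bounds the conditional probability of A given C; with the factor `probᶜ G C` split off,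
  -- such bounds compose as vertices are revealed.
  record CoverableIn (C : Cyl) (q : ℚ) : Set where
    constructor within
    field cover : Coverable (λ ω → _∈ᶜ_ G ω C × A ω) (q * probᶜ G C)

  open CoverableIn public

  coverable-self : ∀ C → CoverableIn C 1ℚ
  coverable-self C = within $
    C ∷ [] ,
    ℚ.≤-reflexive (trans (ℚ.+-identityʳ (probᶜ G C)) (sym (ℚ.*-identityˡ (probᶜ G C)))) ,
    λ ω (ω∈C , _) → here ω∈C

  coverable-impossible : ∀ C → (∀ ω → _∈ᶜ_ G ω C → ¬ A ω) → CoverableIn C 0ℚ
  coverable-impossible C ¬A = within $
    [] , ℚ.≤-reflexive (sym (ℚ.*-zeroˡ (probᶜ G C))) , λ ω (ω∈C , Aω) → contradiction Aω (¬A ω ω∈C)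

  coverable-raise : ∀ C {q r} → q ≤ r → CoverableIn C q → CoverableIn C r
  coverable-raise C q≤r (within cov) = within $
    coverable-weaken (ℚ.*-monoʳ-≤-nonNeg (probᶜ G C) {{probᶜ-nonNeg C}} q≤r) (λ _ p → p) cov

  -- The law of total probability over the six equally likely bijections at a fresh vertex, one of
  -- them singled out.
  coverable-split : ∀ r q {v} C (v∉C : v ∉ dom C) π → CoverableIn (extend v π C v∉C) r →
    (∀ ρ → CoverableIn (extend v ρ C v∉C) q) → CoverableIn C ((+ 1 / 6) * r + (+ 5 / 6) * q)
  coverable-split r q {v} C v∉C π special other = within $ coverable-weaken (ℚ.≤-reflexive (regroup r q (probᶜ G C))) classify
    (coverable-∪ (cover special) (coverable-∪ (via σ₁) (coverable-∪ (via σ₂) (coverable-∪ (via σ₃) (coverable-∪ (via σ₄) (via σ₅))))))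
    where
    open +-*-Solver
    via : ∀ σ → Coverable (λ ω → _∈ᶜ_ G ω (extend v (σ ∘ₚ π) C v∉C) × A ω) (q * probᶜ G (extend v (σ ∘ₚ π) C v∉C))
    via σ = cover (other (σ ∘ₚ π))

    branch : ∀ ω σ → ω v ∘ₚ flip π ≈ σ → ω v ≈ σ ∘ₚ π
    branch ω σ e i = trans (sym (inverseʳ π)) (cong (π ⟨$⟩ʳ_) (e i))

    classify : ∀ ω → _∈ᶜ_ G ω C × A ω → _
    -- The six bijections are enumerated relative to π, as σ ∘ₚ π, so that the singled-out one is
    -- the case σ = `id`.
    classify ω (ω∈C , Aω) with perm₃ (ω v ∘ₚ flip π)
    ... | inj₁ e                             = inj₁ (branch ω id e ∷ ω∈C , Aω)
    ... | inj₂ (inj₁ e)                      = inj₂ (inj₁ (branch ω σ₁ e ∷ ω∈C , Aω))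
    ... | inj₂ (inj₂ (inj₁ e))               = inj₂ (inj₂ (inj₁ (branch ω σ₂ e ∷ ω∈C , Aω)))
    ... | inj₂ (inj₂ (inj₂ (inj₁ e)))        = inj₂ (inj₂ (inj₂ (inj₁ (branch ω σ₃ e ∷ ω∈C , Aω))))
    ... | inj₂ (inj₂ (inj₂ (inj₂ (inj₁ e)))) = inj₂ (inj₂ (inj₂ (inj₂ (inj₁ (branch ω σ₄ e ∷ ω∈C , Aω)))))
    ... | inj₂ (inj₂ (inj₂ (inj₂ (inj₂ e)))) = inj₂ (inj₂ (inj₂ (inj₂ (inj₂ (branch ω σ₅ e ∷ ω∈C , Aω)))))

    regroup : ∀ r q p → let s = (+ 1 / 6) * p in
      r * s + (q * s + (q * s + (q * s + (q * s + q * s)))) ≡ ((+ 1 / 6) * r + (+ 5 / 6) * q) * p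
    regroup = solve 3 (λ r q p → let s = con (+ 1 / 6) :* p in
      r :* s :+ (q :* s :+ (q :* s :+ (q :* s :+ (q :* s :+ q :* s)))) := (con (+ 1 / 6) :* r :+ con (+ 5 / 6) :* q) :* p) refl

  -- Revealing more vertices costs nothing: if all six outcomes have bound q, so does their average.
  -- Vertices already prescribed are skipped, and the outcome D is described only through its
  -- domain.
  coverable-reveal : ∀ q vs C →
    (∀ D → (∀ {v} → v ∈ vs ⊎ v ∈ dom C → v ∈ dom D) → (∀ {v} → v ∈ dom D → v ∈ vs ⊎ v ∈ dom C) → CoverableIn D q) →
    CoverableIn C q
  coverable-reveal q []       C reveal = reveal C (λ { (inj₂ v∈C) → v∈C }) inj₂
  coverable-reveal q (w ∷ vs) C reveal with w ∈? dom C
  ... | yes w∈C = coverable-reveal q vs C λ D C⊆D D⊆C → reveal D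
    (λ { (inj₁ (here refl)) → C⊆D (inj₂ w∈C) ; (inj₁ (there v∈vs)) → C⊆D (inj₁ v∈vs) ; (inj₂ v∈C) → C⊆D (inj₂ v∈C) })
    (λ v∈D → [ inj₁ ∘ there , inj₂ ]′ (D⊆C v∈D))
  ... | no w∉C = subst (CoverableIn C) (average q) (coverable-split q q C w∉C id (branch id) branch)
    where
    open +-*-Solver
    average : ∀ q → (+ 1 / 6) * q + (+ 5 / 6) * q ≡ q
    average = solve 1 (λ q → con (+ 1 / 6) :* q :+ con (+ 5 / 6) :* q := q) refl
    branch : ∀ ρ → CoverableIn (extend w ρ C w∉C) q
    branch ρ = coverable-reveal q vs (extend w ρ C w∉C) λ D C⊆D D⊆C → reveal D
      (λ { (inj₁ (here refl)) → C⊆D (inj₂ (here refl)) ; (inj₁ (there v∈vs)) → C⊆D (inj₁ v∈vs) ; (inj₂ v∈C) → C⊆D (inj₂ (there v∈C)) })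
      (λ v∈D → [ inj₁ ∘ there , (λ { (here refl) → inj₁ (here refl) ; (there v∈C) → inj₂ v∈C }) ]′ (D⊆C v∈D))

-- The walk as a dynamical system on vertices and ports

State : Set
State = HexVertex × Fin 3

step : Labeling G → State → State
step ω (v , p) = hexNbr v (ω v ⟨$⟩ˡ p) , rot p

run : Labeling G → State → ℕ → State
run ω s zero    = s
run ω s (suc t) = step ω (run ω s t)

-- The arc left by port p carries the label of p, and since every degree is 3 the next port is p + 1
-- mod 3, whatever the labeling.
next-leaveBy : ∀ ω v p → next G ω (leaveBy G ω v p) ≡ leaveBy G ω (hexNbr v (ω v ⟨$⟩ˡ p)) (rot p)
next-leaveBy ω v p rewrite inverseʳ (ω v) {p} = cong (leaveBy G ω _) (port p)
  where
  port : ∀ p → suc (toℕ p) mod 3 ≡ rot p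
  port 0F = refl
  port 1F = refl
  port 2F = refl

walk-run : ∀ ω v ℓ t → walk G ω v ℓ t ≡ leaveBy G ω (proj₁ (run ω (v , ℓ) t)) (proj₂ (run ω (v , ℓ) t))
walk-run ω v ℓ zero    = refl
walk-run ω v ℓ (suc t) = trans (cong (next G ω) (walk-run ω v ℓ t)) (next-leaveBy ω _ _)

recurs⇒cycles : ∀ ω v ℓ {s t} → s ℕ.< t → run ω (v , ℓ) s ≡ run ω (v , ℓ) t → Cycles G v ℓ ω
recurs⇒cycles ω v ℓ {s} {t} s<t e = s , t , s<t ,
  trans (walk-run ω v ℓ s) (trans (cong (λ (w , p) → leaveBy G ω w p) e) (sym (walk-run ω v ℓ t)))

-- The first t steps read the labeling only at the vertices occupied before time t. The premise
-- follows the run of ω′, which will be the one known explicitly.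
run-agree : ∀ ω ω′ s t → (∀ r → r ℕ.< t → ω (proj₁ (run ω′ s r)) ≈ ω′ (proj₁ (run ω′ s r))) → run ω s t ≡ run ω′ s t
run-agree ω ω′ s zero    agree = refl
run-agree ω ω′ s (suc t) agree rewrite run-agree ω ω′ s t (λ r r<t → agree r (ℕ.m<n⇒m<1+n r<t)) =
  let v , p = run ω′ s t in
  cong (λ i → hexNbr v i , rot p) (≈⇒⟨$⟩ˡ (ω v) (ω′ v) (agree t ℕ.≤-refl) p)

-- A concrete labeling along which the walk can be computed. The default `id` is harmless, because
-- labels are compared with those of ω only inside the prescribed domain.
completion : List (HexVertex × Perm) → Labeling G
completion []            v = id
completion ((w , π) ∷ σ) v with v ≟ᵛ w
... | yes _ = π
... | no _  = completion σ v

∈ᶜ⇒≈completion : ∀ (ω : Labeling G) {v} σ → All (λ (w , π) → ω w ≈ π) σ → v ∈ map proj₁ σ → ω v ≈ completion σ v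
∈ᶜ⇒≈completion ω {v} ((w , π) ∷ σ) (ωw ∷ ωσ) v∈         with v ≟ᵛ w
∈ᶜ⇒≈completion ω     ((w , π) ∷ σ) (ωw ∷ ωσ) v∈         | yes refl = ωw
∈ᶜ⇒≈completion ω     ((w , π) ∷ σ) (ωw ∷ ωσ) (here v≡w) | no v≢w   = contradiction v≡w v≢w
∈ᶜ⇒≈completion ω     ((w , π) ∷ σ) (ωw ∷ ωσ) (there v∈) | no _     = ∈ᶜ⇒≈completion ω σ ωσ v∈

confined⇒recurs : ∀ ω s vs → (∀ t → t ℕ.≤ length (cartesianProduct vs (allFin 3)) → proj₁ (run ω s t) ∈ vs) →
  ∃[ i ] ∃[ j ] i ℕ.< j × j ℕ.≤ length (cartesianProduct vs (allFin 3)) × run ω s i ≡ run ω s j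
confined⇒recurs ω s vs confined =
  -- The times 0 to `length states` are one more than the available states.
  let i , j , i<j , e = pigeonhole ℕ.≤-refl (λ t → Any.index (position t)) in
  toℕ i , toℕ j , i<j , ℕ.s≤s⁻¹ (toℕ<n j) ,
  trans (lookup-index (position i)) (trans (cong (lookup states) e) (sym (lookup-index (position j))))
  where
  states : List State
  states = cartesianProduct vs (allFin 3)
  position : ∀ (t : Fin (suc (length states))) → run ω s (toℕ t) ∈ states
  position t = ∈-cartesianProduct⁺ (confined (toℕ t) (ℕ.s≤s⁻¹ (toℕ<n t))) (∈-allFin _)

-- The reference directions form a proper 3-edge-colouring: an edge has the same index at both ends.
hexNbr-involutive : ∀ v i → hexNbr (hexNbr v i) i ≡ v
hexNbr-involutive (black a b) 0F = refl
hexNbr-involutive (black a b) 1F = cong (λ x → black x b) (ℤ.suc-pred a)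
hexNbr-involutive (black a b) 2F = cong (black a) (ℤ.suc-pred b)
hexNbr-involutive (white a b) 0F = refl
hexNbr-involutive (white a b) 1F = cong (λ x → white x b) (ℤ.pred-suc a)
hexNbr-involutive (white a b) 2F = cong (white a) (ℤ.pred-suc b)

-- The walk bounces u → c → x₁ → c → x₂ → c → u, where x₁ and x₂ are the
-- neighbours of c other than u.
module Trap (u : HexVertex) (k i : Fin 3) where
  c x₁ x₂ : HexVertex
  c  = hexNbr u i
  x₁ = hexNbr c (rot (rot i))
  x₂ = hexNbr c (rot i)

  trap : ∀ ω → ω u ⟨$⟩ˡ k ≡ i → ω c ≈ align k (rot i) → ω x₁ ≈ align k i → ω x₂ ≈ align k i →
    (step ω ∘ step ω ∘ step ω ∘ step ω ∘ step ω ∘ step ω) (u , k) ≡ (u , k)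
  -- The ports used are k, k+1, k+2, k, k+1, k+2. The three visits to c use ports k+1, k, k+2, which
  -- `align k (rot i)` sends to directions i+2, i+1, i; these are consistent, since the ports
  -- differ. At x₁ port k+2 and at x₂ port k+1 lead back to c.
  trap ω ωu ωc ωx₁ ωx₂ = begin
    (step ω ∘ step ω ∘ step ω ∘ step ω ∘ step ω ∘ step ω) (u , k)
      ≡⟨ cong (step ω ∘ step ω ∘ step ω ∘ step ω ∘ step ω) (move u k ωu) ⟩
    (step ω ∘ step ω ∘ step ω ∘ step ω ∘ step ω) (c , rot k)
      ≡⟨ cong (step ω ∘ step ω ∘ step ω ∘ step ω) (move c (rot k) (at c (align k (rot i)) ωc (align-1 k (rot i)))) ⟩
    (step ω ∘ step ω ∘ step ω ∘ step ω) (x₁ , rot (rot k))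
      ≡⟨ cong (step ω ∘ step ω ∘ step ω) (move x₁ (rot (rot k)) (at x₁ (align k i) ωx₁ (align-2 k i))) ⟩
    (step ω ∘ step ω ∘ step ω) (hexNbr x₁ (rot (rot i)) , rot (rot (rot k)))
      ≡⟨ cong (step ω ∘ step ω ∘ step ω) (cong₂ _,_ (hexNbr-involutive c (rot (rot i))) (rot³ k)) ⟩
    (step ω ∘ step ω ∘ step ω) (c , k)
      ≡⟨ cong (step ω ∘ step ω) (move c k (at c (align k (rot i)) ωc (align-0 k (rot i)))) ⟩
    (step ω ∘ step ω) (x₂ , rot k)
      ≡⟨ cong (step ω) (move x₂ (rot k) (at x₂ (align k i) ωx₂ (align-1 k i))) ⟩
    step ω (hexNbr x₂ (rot i) , rot (rot k))
      ≡⟨ cong (λ v → step ω (v , rot (rot k))) (hexNbr-involutive c (rot i)) ⟩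
    step ω (c , rot (rot k))
      ≡⟨ move c (rot (rot k)) (at c (align k (rot i)) ωc (trans (align-2 k (rot i)) (rot³ i))) ⟩
    hexNbr c i , rot (rot (rot k))
      ≡⟨ cong₂ _,_ (hexNbr-involutive u i) (rot³ k) ⟩
    u , k
      ∎
    where
    open ≡-Reasoning
    move : ∀ v p {j} → ω v ⟨$⟩ˡ p ≡ j → step ω (v , p) ≡ (hexNbr v j , rot p)
    move v p e = cong (λ x → hexNbr v x , rot p) e
    at : ∀ v π → ω v ≈ π → ∀ {p j} → π ⟨$⟩ˡ p ≡ j → ω v ⟨$⟩ˡ p ≡ j
    at v π ωv {p} = trans (≈⇒⟨$⟩ˡ (ω v) π ωv p)

-- Boxes

xy : HexVertex → ℤ × ℤ
xy (black a b) = a , b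
xy (white a b) = a , b

-- Boxes are unions of whole unit cells, so an edge in direction 0 never leaves one.
InBox : ℕ → HexVertex → Set
InBox m v = ∣ proj₁ (xy v) ∣ ℕ.≤ m × ∣ proj₂ (xy v) ∣ ℕ.≤ m

inBox? : ∀ m v → Dec (InBox m v)
inBox? m v = ∣ proj₁ (xy v) ∣ ℕ.≤? m ×-dec ∣ proj₂ (xy v) ∣ ℕ.≤? m

interval : ℕ → List ℤ
interval zero    = + 0 ∷ []
interval (suc m) = +[1+ m ] ∷ -[1+ m ] ∷ interval m

∈-interval⁺ : ∀ m i → ∣ i ∣ ℕ.≤ m → i ∈ interval m
∈-interval⁺ zero    (+ zero)  _ = here refl
∈-interval⁺ (suc m) i         i≤ with ℕ.m≤n⇒m<n∨m≡n i≤
∈-interval⁺ (suc m) i         i≤ | inj₁ i<   = there (there (∈-interval⁺ m i (ℕ.s≤s⁻¹ i<)))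
∈-interval⁺ (suc m) (+ n)     i≤ | inj₂ refl = here refl
∈-interval⁺ (suc m) -[1+ n ]  i≤ | inj₂ refl = there (here refl)

∈-interval⁻ : ∀ m {i} → i ∈ interval m → ∣ i ∣ ℕ.≤ m
∈-interval⁻ zero    (here refl)         = z≤n
∈-interval⁻ (suc m) (here refl)         = ℕ.≤-refl
∈-interval⁻ (suc m) (there (here refl)) = ℕ.≤-refl
∈-interval⁻ (suc m) (there (there i∈))  = ℕ.m≤n⇒m≤1+n (∈-interval⁻ m i∈)

box : ℕ → List HexVertex
box m = cartesianProductWith black (interval m) (interval m) ++ cartesianProductWith white (interval m) (interval m)

∈-box⁺ : ∀ {m} v → InBox m v → v ∈ box m
∈-box⁺ {m} (black a b) (a≤ , b≤) = ∈-++⁺ˡ (∈-cartesianProductWith⁺ black (∈-interval⁺ m a a≤) (∈-interval⁺ m b b≤))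
∈-box⁺ {m} (white a b) (a≤ , b≤) = ∈-++⁺ʳ _ (∈-cartesianProductWith⁺ white (∈-interval⁺ m a a≤) (∈-interval⁺ m b b≤))

∈-box⁻ : ∀ m {v} → v ∈ box m → InBox m v
∈-box⁻ m v∈ with ∈-++⁻ (cartesianProductWith black (interval m) (interval m)) v∈
... | inj₁ v∈b with _ , _ , a∈ , b∈ , refl ← ∈-cartesianProductWith⁻ black (interval m) (interval m) v∈b = ∈-interval⁻ m a∈ , ∈-interval⁻ m b∈
... | inj₂ v∈w with _ , _ , a∈ , b∈ , refl ← ∈-cartesianProductWith⁻ white (interval m) (interval m) v∈w = ∈-interval⁻ m a∈ , ∈-interval⁻ m b∈

InBox-suc : ∀ {m} v → InBox m v → InBox (suc m) v
InBox-suc v (a≤ , b≤) = ℕ.m≤n⇒m≤1+n a≤ , ℕ.m≤n⇒m≤1+n b≤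

InBox-nbr : ∀ {m} v i → InBox m v → InBox (suc m) (hexNbr v i)
InBox-nbr (black a b) 0F = InBox-suc (black a b)
InBox-nbr (white a b) 0F = InBox-suc (white a b)
InBox-nbr (black a b) 1F (a≤ , b≤) = ℕ.≤-trans (ℤ.∣i+j∣≤∣i∣+∣j∣ -[1+ 0 ] a) (s≤s a≤) , ℕ.m≤n⇒m≤1+n b≤
InBox-nbr (white a b) 1F (a≤ , b≤) = ℕ.≤-trans (ℤ.∣i+j∣≤∣i∣+∣j∣ (+ 1) a) (s≤s a≤) , ℕ.m≤n⇒m≤1+n b≤
InBox-nbr (black a b) 2F (a≤ , b≤) = ℕ.m≤n⇒m≤1+n a≤ , ℕ.≤-trans (ℤ.∣i+j∣≤∣i∣+∣j∣ -[1+ 0 ] b) (s≤s b≤)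
InBox-nbr (white a b) 2F (a≤ , b≤) = ℕ.m≤n⇒m≤1+n a≤ , ℕ.≤-trans (ℤ.∣i+j∣≤∣i∣+∣j∣ (+ 1) b) (s≤s b≤)

-- Only one coordinate leaves its range on the way out, and the other two
-- directions at the new vertex do not change that coordinate.
exit-nbr : ∀ {m} u i j → InBox m u → ¬ InBox m (hexNbr u i) → j ≢ i → ¬ InBox m (hexNbr (hexNbr u i) j)
exit-nbr (black a b) 0F j  u∈        c∉ _ = contradiction u∈ c∉
exit-nbr (white a b) 0F j  u∈        c∉ _ = contradiction u∈ c∉
exit-nbr (black a b) 1F 0F u∈        c∉ _ = c∉
exit-nbr (white a b) 1F 0F u∈        c∉ _ = c∉
exit-nbr (black a b) 2F 0F u∈        c∉ _ = c∉
exit-nbr (white a b) 2F 0F u∈        c∉ _ = c∉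
exit-nbr (black a b) 1F 2F (_ , b≤)  c∉ _ (a≤ , _) = c∉ (a≤ , b≤)
exit-nbr (white a b) 1F 2F (_ , b≤)  c∉ _ (a≤ , _) = c∉ (a≤ , b≤)
exit-nbr (black a b) 2F 1F (a≤ , _)  c∉ _ (_ , b≤) = c∉ (a≤ , b≤)
exit-nbr (white a b) 2F 1F (a≤ , _)  c∉ _ (_ , b≤) = c∉ (a≤ , b≤)
exit-nbr u           1F 1F u∈        c∉ j≢i = contradiction refl j≢i
exit-nbr u           2F 2F u∈        c∉ j≢i = contradiction refl j≢i

-- A search up to the horizon T, which keeps the alternative decidable; it finds the first exit.
stays-or-exits : ∀ ω m s T → InBox m (proj₁ s) →
  (∀ t → t ℕ.≤ T → InBox m (proj₁ (run ω s t))) ⊎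
  (∃[ t ] (∀ r → r ℕ.≤ t → InBox m (proj₁ (run ω s r))) × ¬ InBox m (proj₁ (run ω s (suc t))))
stays-or-exits ω m s zero    s∈ = inj₁ λ { zero z≤n → s∈ }
stays-or-exits ω m s (suc T) s∈ with stays-or-exits ω m s T s∈
... | inj₂ exits = inj₂ exits
... | inj₁ stays with inBox? m (proj₁ (run ω s (suc T)))
...   | no  out = inj₂ (T , stays , out)
...   | yes ins = inj₁ λ t t≤ → [ stays t ∘ ℕ.s≤s⁻¹ , (λ { refl → ins }) ]′ (ℕ.m≤n⇒m<n∨m≡n t≤)

-- One round of the trap, and its iteration over growing boxes

module _ (v₀ : HexVertex) (ℓ : Fin 3) where

  open Covering (λ ω → ¬ Cycles G v₀ ℓ ω)

  -- One round gains the factor 215/216. It may prescribe c, x₁ and x₂, which lie at most two steps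
  -- beyond the box; hence the radius 2 + m for the continuation.
  attempt : ∀ q {{_ : NonNegative q}} m C → InBox m v₀ →
    (∀ {v} → InBox m v → v ∈ dom C) → (∀ {v} → v ∈ dom C → InBox m v) →
    (∀ D → (∀ {v} → v ∈ dom D → InBox (2 ℕ.+ m) v) → CoverableIn D q) → CoverableIn C (ratio * q)
  attempt q m C v₀∈ box⊆C C⊆box continue =
    -- The horizon is the number of states over the box, enough for the pigeonhole principle when
    -- the walk stays inside.
    [ confined , escaping ]′ (stays-or-exits ω̂ m (v₀ , ℓ) (length (cartesianProduct (dom C) (allFin 3))) v₀∈)
    where
    ω̂ : Labeling G
    ω̂ = completion (prescribed C)

    confined : (∀ t → t ℕ.≤ length (cartesianProduct (dom C) (allFin 3)) → InBox m (proj₁ (run ω̂ (v₀ , ℓ) t))) → CoverableIn C (ratio * q)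
    -- Every labeling in C cycles here, so the bound is 0.
    confined stays = coverable-raise C (ℚ.nonNegative⁻¹ (ratio * q) {{ℚ.nonNeg*nonNeg⇒nonNeg ratio q}}) (coverable-impossible C cycles)
      where
      cycles : ∀ ω → _∈ᶜ_ G ω C → ¬ ¬ Cycles G v₀ ℓ ω
      cycles ω ω∈C ¬cyc with i , j , i<j , j≤ , e ← confined⇒recurs ω̂ (v₀ , ℓ) (dom C) (λ t t≤ → box⊆C (stays t t≤)) =
        ¬cyc (recurs⇒cycles ω v₀ ℓ i<j (trans (agree i (ℕ.≤-trans (ℕ.<⇒≤ i<j) j≤)) (trans e (sym (agree j j≤)))))
        where
        agree : ∀ t → t ℕ.≤ _ → run ω (v₀ , ℓ) t ≡ run ω̂ (v₀ , ℓ) t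
        agree t t≤ = run-agree ω ω̂ (v₀ , ℓ) t λ r r<t →
          ∈ᶜ⇒≈completion ω (prescribed C) ω∈C (box⊆C (stays r (ℕ.≤-trans (ℕ.<⇒≤ r<t) t≤)))

    escaping : (∃[ t ] (∀ r → r ℕ.≤ t → InBox m (proj₁ (run ω̂ (v₀ , ℓ) r))) × ¬ InBox m (proj₁ (run ω̂ (v₀ , ℓ) (suc t)))) → CoverableIn C (ratio * q)
    escaping (t , stays , out) =
      subst (CoverableIn C) (decay q)
        -- The vertices c, x₁, x₂ are revealed in turn. A first wrong value ends the round with
        -- bound q, and three right values make the walk cycle.
        (coverable-split _ q C c∉ (align k (rot i))
          (coverable-split _ q C₁ x₁∉ (align k i)
            (coverable-split 0ℚ q C₂ x₂∉ (align k i)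
              (coverable-impossible (extend x₂ (align k i) C₂ x₂∉) trapped)
              λ ρ → continue (extend x₂ ρ C₂ x₂∉)
                λ { (here refl) → x₂∈ ; (there (here refl)) → x₁∈ ; (there (there (here refl))) → c∈ ; (there (there (there v∈))) → C∈ v∈ })
            λ ρ → continue (extend x₁ ρ C₁ x₁∉)
              λ { (here refl) → x₁∈ ; (there (here refl)) → c∈ ; (there (there v∈)) → C∈ v∈ })
          λ ρ → continue (extend c ρ C c∉)
            λ { (here refl) → c∈ ; (there v∈) → C∈ v∈ })
      where
      u : HexVertex
      u = proj₁ (run ω̂ (v₀ , ℓ) t)
      k i : Fin 3
      k = proj₂ (run ω̂ (v₀ , ℓ) t)
      i = ω̂ u ⟨$⟩ˡ k

      open Trap u k i
      open Graph G using (simple; loopless)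

      u∈ : InBox m u
      u∈ = stays t ℕ.≤-refl

      c∈ : InBox (2 ℕ.+ m) c
      c∈ = InBox-suc c (InBox-nbr u i u∈)
      x₁∈ : InBox (2 ℕ.+ m) x₁
      x₁∈ = InBox-nbr c (rot (rot i)) (InBox-nbr u i u∈)
      x₂∈ : InBox (2 ℕ.+ m) x₂
      x₂∈ = InBox-nbr c (rot i) (InBox-nbr u i u∈)
      C∈ : ∀ {v} → v ∈ dom C → InBox (2 ℕ.+ m) v
      C∈ {v} v∈ = InBox-suc v (InBox-suc v (C⊆box v∈))

      c∉ : c ∉ dom C
      c∉ c∈C = out (C⊆box c∈C)
      C₁ : Cyl
      C₁ = extend c (align k (rot i)) C c∉

      x₁∉ : x₁ ∉ dom C₁
      x₁∉ (here x₁≡c)   = loopless c (rot (rot i)) x₁≡c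
      x₁∉ (there x₁∈C)  = exit-nbr u i (rot (rot i)) u∈ out (rot²-≢ i) (C⊆box x₁∈C)
      C₂ : Cyl
      C₂ = extend x₁ (align k i) C₁ x₁∉

      x₂∉ : x₂ ∉ dom C₂
      x₂∉ (here x₂≡x₁)         = rot-≢ (rot i) (sym (simple c x₂≡x₁))
      x₂∉ (there (here x₂≡c))  = loopless c (rot i) x₂≡c
      x₂∉ (there (there x₂∈C)) = exit-nbr u i (rot i) u∈ out (rot-≢ i) (C⊆box x₂∈C)

      trapped : ∀ ω → _∈ᶜ_ G ω (extend x₂ (align k i) C₂ x₂∉) → ¬ ¬ Cycles G v₀ ℓ ω
      trapped ω (ωx₂ ∷ ωx₁ ∷ ωc ∷ ω∈C) ¬cyc = ¬cyc (recurs⇒cycles ω v₀ ℓ {t} {6 ℕ.+ t} (ℕ.m≤n+m (suc t) 5) (sym returns))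
        where
        agrees : ∀ {v} → InBox m v → ω v ≈ ω̂ v
        agrees v∈ = ∈ᶜ⇒≈completion ω (prescribed C) ω∈C (box⊆C v∈)
        reaches : run ω (v₀ , ℓ) t ≡ (u , k)
        reaches = run-agree ω ω̂ (v₀ , ℓ) t λ r r<t → agrees (stays r (ℕ.<⇒≤ r<t))
        returns : run ω (v₀ , ℓ) (6 ℕ.+ t) ≡ run ω (v₀ , ℓ) t
        returns = trans (cong (step ω ∘ step ω ∘ step ω ∘ step ω ∘ step ω ∘ step ω) reaches)
          (trans (trap ω (≈⇒⟨$⟩ˡ (ω u) (ω̂ u) (agrees u∈) k) ωc ωx₁ ωx₂) (sym reaches))

      -- The failing branches weigh 5/6 + 5/36 + 5/216 = 215/216.
      decay : ∀ q → (+ 1 / 6) * ((+ 1 / 6) * ((+ 1 / 6) * 0ℚ + (+ 5 / 6) * q) + (+ 5 / 6) * q) + (+ 5 / 6) * q ≡ ratio * q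
      decay = solve 1 (λ q → con (+ 1 / 6) :* (con (+ 1 / 6) :* (con (+ 1 / 6) :* con 0ℚ :+ con (+ 5 / 6) :* q) :+ con (+ 5 / 6) :* q)
        :+ con (+ 5 / 6) :* q := con ratio :* q) refl
        where open +-*-Solver

  -- A failed round leaves a domain that lies in the larger box but need not fill it, so each round
  -- first reveals the rest of the box.
  coverable-ratio^ : ∀ n m C → InBox m v₀ → (∀ {v} → v ∈ dom C → InBox m v) → CoverableIn C (ratio^ n)
  coverable-ratio^ zero    m C v₀∈ C⊆box = coverable-self C
  coverable-ratio^ (suc n) m C v₀∈ C⊆box = coverable-reveal (ratio^ suc n) (box m) C λ D D⊇ D⊆ →
    attempt (ratio^ n) {{ratio^-nonNeg n}} m D v₀∈ (λ {v} v∈ → D⊇ (inj₁ (∈-box⁺ v v∈)))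
      (λ v∈D → [ ∈-box⁻ m , C⊆box ]′ (D⊆ v∈D))
      λ E E⊆ → coverable-ratio^ n (2 ℕ.+ m) E (InBox-suc v₀ (InBox-suc v₀ v₀∈)) E⊆

  noncycling-coverable : ∀ δ → 0ℚ ℚ.< δ → Coverable (λ ω → ¬ Cycles G v₀ ℓ ω) δ
  noncycling-coverable δ δ>0 = weaken (ratio^→0 δ δ>0)
    where
    radius : ℕ
    -- The least box containing the start; the iteration begins from the empty cylinder, of
    -- probability 1.
    radius = ∣ proj₁ (xy v₀) ∣ ⊔ ∣ proj₂ (xy v₀) ∣

    weaken : ∃[ n ] ratio^ n ≤ δ → Coverable (λ ω → ¬ Cycles G v₀ ℓ ω) δ
    weaken (n , small) =
      coverable-weaken (ℚ.≤-trans (ℚ.≤-reflexive (ℚ.*-identityʳ (ratio^ n))) small) (λ ω ¬cyc → [] , ¬cyc)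
        (cover (coverable-ratio^ n radius empty (ℕ.m≤m⊔n _ _ , ℕ.m≤n⊔m _ _) λ ()))

theorem4p3 : (v₀ : Graph.Vertex hexagonalLattice) (ℓ : Fin (Graph.deg hexagonalLattice v₀)) → ProbabilityOne hexagonalLattice (Cycles hexagonalLattice v₀ ℓ)
theorem4p3 v₀ ℓ = coverable⇒null (noncycling-coverable v₀ ℓ)
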